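{- For all expressions $D$ and $E$ of $\mathrm{DC}\mu\nu$, $D\longrightarrow_{\mathrm{DC}\mu\nu}E$ implies $(D)^\circ\longrightarrow_{\mathrm{DC}\mu\nu}(E)^\circ$.
   Context: Syntax. Type variables $X,Y,\dots$ (set $\mathrm{TyVars}$), variables $x,y,z,\dots$ and covariables $\alpha,\beta,\gamma,\dots$ are given, with a fixed involution $(-)'$ between variables and covariables ($x''=x$, $\alpha''=\alpha$). Types of $\mathrm{DC}\mu\nu$: $A::=X\mid A\land A\mid A\lor A\mid\neg A\mid\mu X.A\mid\nu X.A$, where $\mu X.A$ and $\nu X.A$ (binding $X$ in $A$) are formed only if $X\in\mathrm{Pos}(A)$; simultaneously, $\mathrm{Pos}(X)=\mathrm{TyVars}$, $\mathrm{Neg}(X)=\mathrm{TyVars}\setminus\{X\}$, $\mathrm{Pos}(A\land B)=\mathrm{Pos}(A\lor B)=\mathrm{Pos}(A)\cap\mathrm{Pos}(B)$, $\mathrm{Neg}(A\land B)=\mathrm{Neg}(A\lor B)=\mathrm{Neg}(A)\cap\mathrm{Neg}(B)$, $\mathrm{Pos}(\neg A)=\mathrm{Neg}(A)$, $\mathrm{Neg}(\neg A)=\mathrm{Pos}(A)$, $\mathrm{Pos}(\mu X.A)=\mathrm{Pos}(\nu X.A)=\mathrm{Pos}(A)\cup\{X\}$, $\mathrm{Neg}(\mu X.A)=\mathrm{Neg}(\nu X.A)=\mathrm{Neg}(A)\cup\{X\}$. Terms: $M::=x\mid\langle M,M\rangle\mid\langle M\rangle\mathsf{inl}\mid\langle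 M\rangle\mathsf{inr}\mid[K]\mathsf{not}\mid(S).\alpha\mid\mathsf{in}^{\mu X.A}\langle M\rangle\mid\mathsf{coitr}^A_x\langle M,M\rangle$. Coterms: $K::=\alpha\mid[K,K]\mid\mathsf{fst}[K]\mid\mathsf{snd}[K]\mid\mathsf{not}\langle M\rangle\mid x.(S)\mid\mathsf{out}^{\nu X.A}[K]\mid\mathsf{itr}^A_\alpha[K,K]$. Statements: $S::=M\bullet K$. An expression ($D,E,\dots$) is a term ($M,N$), a coterm ($K,L$) or a statement ($S,T$). $(S).\alpha$ binds $\alpha$ in $S$, $x.(S)$ binds $x$ in $S$, $\mathsf{itr}^A_\alpha[K,L]$ binds $\alpha$ in $K$ only, $\mathsf{coitr}^A_x\langle M,N\rangle$ binds $x$ in $M$ only. Types and expressions are identified up to renaming of bound names; substitution is capture-avoiding. Duality transformation. Types: $(X)^\circ=X$, $(\neg A)^\circ=\neg(A)^\circ$, $(A\land B)^\circ=(A)^\circ\lor(B)^\circ$, $(A\lor B)^\circ=(A)^\circ\land(B)^\circ$, $(\mu X.A)^\circ=\nu X.(A)^\circ$, $(\nu X.A)^\circ=\mu X.(A)^\circ$. Expressions: $(x)^\circ=x'$, $(\alpha)^\circ=\alpha'$, $(\langle M,N\rangle)^\circ=[(M)^\circ,(N)^\circ]$, $([K,L])^\circ=\langle(K)^\circ,(L)^\circ\rangle$, $(\langle M\rangle\mathsf{inl})^\circ=\mathsf{fst}[(M)^\circ]$, $(\mathsf{fst}[K])^\circ=\langle(K)^\circ\rangle\mathsf{inl}$,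 $(\langle M\rangle\mathsf{inr})^\circ=\mathsf{snd}[(M)^\circ]$, $(\mathsf{snd}[K])^\circ=\langle(K)^\circ\rangle\mathsf{inr}$, $([K]\mathsf{not})^\circ=\mathsf{not}\langle(K)^\circ\rangle$, $(\mathsf{not}\langle M\rangle)^\circ=[(M)^\circ]\mathsf{not}$, $((S).\alpha)^\circ=\alpha'.((S)^\circ)$, $(x.(S))^\circ=((S)^\circ).x'$, $(M\bullet K)^\circ=(K)^\circ\bullet(M)^\circ$, $(\mathsf{in}^{\mu X.A}\langle M\rangle)^\circ=\mathsf{out}^{\nu X.(A)^\circ}[(M)^\circ]$, $(\mathsf{out}^{\nu X.A}[K])^\circ=\mathsf{in}^{\mu X.(A)^\circ}\langle(K)^\circ\rangle$, $(\mathsf{itr}^A_\alpha[K,L])^\circ=\mathsf{coitr}^{(A)^\circ}_{\alpha'}\langle(K)^\circ,(L)^\circ\rangle$, $(\mathsf{coitr}^A_x\langle M,N\rangle)^\circ=\mathsf{itr}^{(A)^\circ}_{x'}[(M)^\circ,(N)^\circ]$. The operator $\mathsf{mono}$. For a type $C$ and type variable $X$ let $\|C\|_X=0$ if $X$ is not free in $C$, and otherwise $\|X\|_X=1$, $\|A\land B\|_X=\|A\lor B\|_X=\|A\|_X+\|B\|_X+1$, $\|\neg A\|_X=\|A\|_X+1$, $\|\mu Y.A\|_X=\|\nu Y.A\|_X=\|A\|_X+\|A\|_Y+1$. For $X$ not free in $A,B$, the term $\mathsf{mono}^{X.C}_{A,B,x.M}\{N\}$ is defined by recursion on $\|C\|_X$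 (newly introduced names $y,z,\alpha,\beta,\gamma$ are fresh): $\mathsf{mono}^{X.X}_{A,B,x.M}\{N\}=(N\bullet x.(M\bullet\alpha)).\alpha$; $\mathsf{mono}^{X.C}_{A,B,x.M}\{N\}=N$ if $X$ does not occur in $C$; $\mathsf{mono}^{X.C\land D}_{A,B,x.M}\{N\}=\langle\mathsf{mono}^{X.C}_{A,B,x.M}\{(N\bullet\mathsf{fst}[\alpha]).\alpha\},\mathsf{mono}^{X.D}_{A,B,x.M}\{(N\bullet\mathsf{snd}[\beta]).\beta\}\rangle$; $\mathsf{mono}^{X.C\lor D}_{A,B,x.M}\{N\}=(N\bullet[y.(\langle\mathsf{mono}^{X.C}_{A,B,x.M}\{y\}\rangle\mathsf{inl}\bullet\gamma),z.(\langle\mathsf{mono}^{X.D}_{A,B,x.M}\{z\}\rangle\mathsf{inr}\bullet\gamma)]).\gamma$; $\mathsf{mono}^{X.\neg C}_{A,B,x.M}\{N\}=[z.(N\bullet\mathsf{not}\langle\mathsf{mono}^{X.C}_{B,A,x.M}\{z\}\rangle)]\mathsf{not}$; $\mathsf{mono}^{X.\mu Y.C}_{A,B,x.M}\{N\}=(N\bullet\mathsf{itr}^{\mu Y.C[B/X]}_\alpha[z.(\mathsf{in}^{\mu Y.C[B/X]}\langle\mathsf{mono}^{X.C[\mu Y.C[B/X]/Y]}_{A,B,x.M}\{z\}\rangle\bullet\alpha),\beta]).\beta$; $\mathsf{mono}^{X.\nu Y.C}_{A,B,x.M}\{N\}=\mathsf{coitr}^{\nu Y.C[A/X]}_z\langle\mathsf{mono}^{X.C[\nu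 Y.C[A/X]/Y]}_{A,B,x.M}\{(z\bullet\mathsf{out}^{\nu Y.C[A/X]}[\alpha]).\alpha\},N\rangle$. For coterms, $\mathsf{mono}^{X.C}_{A,B,\alpha.K}\{L\}=(\mathsf{mono}^{X.(C)^\circ}_{(B)^\circ,(A)^\circ,\alpha'.(K)^\circ}\{(L)^\circ\})^\circ$. Write $\mathsf{mono}^{X.C}_{A,B,x}\{M,N\}$ for $\mathsf{mono}^{X.C}_{A,B,x.M}\{N\}$ and $\mathsf{mono}^{X.C}_{A,B,\alpha}\{K,L\}$ for $\mathsf{mono}^{X.C}_{A,B,\alpha.K}\{L\}$. Reduction. $\longrightarrow_{\mathrm{DC}\mu\nu}$ is the compatible closure (one-step, closure under all expression constructors) of: $\langle M,N\rangle\bullet\mathsf{fst}[K]\to M\bullet K$; $\langle M,N\rangle\bullet\mathsf{snd}[K]\to N\bullet K$; $\langle M\rangle\mathsf{inl}\bullet[K,L]\to M\bullet K$; $\langle M\rangle\mathsf{inr}\bullet[K,L]\to M\bullet L$; $[K]\mathsf{not}\bullet\mathsf{not}\langle M\rangle\to M\bullet K$; $(S).\alpha\bullet K\to S[K/\alpha]$; $M\bullet x.(S)\to S[M/x]$; $(M\bullet\alpha).\alpha\to M$ ($\alpha$ not free in $M$); $x.(x\bullet K)\to K$ ($x$ not free in $K$); $(\beta\mu)$ $\mathsf{in}^{\mu X.C}\langle M\rangle\bullet\mathsf{itr}^A_\alpha[K,L]\to(M\bullet\mathsf{mono}^{X.C}_{\mu X.C,A,\beta}\{\mathsf{itr}^A_\alpha[K,\beta],K\}).\alpha\bullet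 L$; $(\beta\nu)$ $\mathsf{coitr}^A_x\langle M,N\rangle\bullet\mathsf{out}^{\nu X.C}[K]\to N\bullet x.(\mathsf{mono}^{X.C}_{A,\nu X.C,z}\{\mathsf{coitr}^A_x\langle M,z\rangle,M\}\bullet K)$. -}

module Defs where

open import Data.Bool.Base using (if_then_else_)
open import Data.Empty using (⊥-elim)
open import Data.Fin.Base using (Fin; zero; suc; lift)
open import Data.Fin.Properties using (_≟_; suc-injective)
open import Data.Nat.Base as ℕ using (ℕ; zero; suc; _≤_; _<_; z≤n; s≤s)
open import Data.Nat.Induction using (<-wellFounded)
open import Data.Nat.Properties
  using (≤-refl; ≤-trans; ≤-reflexive; +-mono-≤; +-monoˡ-≤; m≤m+n; m≤n+m; +-comm)
open import Data.Product.Base using (_×_; _,_; proj₁; proj₂)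
open import Data.Sum.Base as Sum using (_⊎_; inj₁; inj₂)
open import Data.Unit.Base using (⊤; tt)
open import Function.Base using (_∘_; id)
open import Induction.WellFounded using (Acc; acc)
open import Relation.Binary.PropositionalEquality
  using (_≡_; _≢_; refl; sym; cong)
open import Relation.Nullary using (¬_; Dec; yes; no; does; contradiction)
open import Relation.Nullary.Decidable using (_⊎-dec_)

------------------------------------------------------------------------
-- Bound names are de Bruijn indices, so propositional equality is
-- identity up to renaming of bound names.  `Ty n` has its free type variables
-- among n given ones.  Positivity proofs are irrelevant: they restrict which
-- fixed points exist, but do not distinguish between them.

infix  4 _∈Pos_ _∈Neg_
infixr 7 _∧_
infixr 6 _∨_
infix  8 ~_

data Ty : ℕ → Set
_∈Pos_ : ∀ {n} → Fin n → Ty n → Set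
_∈Neg_ : ∀ {n} → Fin n → Ty n → Set

data Ty where
  tv  : ∀ {n} → Fin n → Ty n
  _∧_ : ∀ {n} → Ty n → Ty n → Ty n
  _∨_ : ∀ {n} → Ty n → Ty n → Ty n
  ~_  : ∀ {n} → Ty n → Ty n
  μ   : ∀ {n} (A : Ty (suc n)) → .(zero ∈Pos A) → Ty n
  ν   : ∀ {n} (A : Ty (suc n)) → .(zero ∈Pos A) → Ty n

-- The bound name is not in scope outside the binder, so adding it to
-- Pos(A) or Neg(A) has no counterpart in the clauses for μ and ν.

x ∈Pos tv y    = ⊤
x ∈Pos (A ∧ B) = x ∈Pos A × x ∈Pos B
x ∈Pos (A ∨ B) = x ∈Pos A × x ∈Pos B
x ∈Pos (~ A)   = x ∈Neg A
x ∈Pos μ A _   = suc x ∈Pos A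
x ∈Pos ν A _   = suc x ∈Pos A

x ∈Neg tv y    = x ≢ y
x ∈Neg (A ∧ B) = x ∈Neg A × x ∈Neg B
x ∈Neg (A ∨ B) = x ∈Neg A × x ∈Neg B
x ∈Neg (~ A)   = x ∈Pos A
x ∈Neg μ A _   = suc x ∈Neg A
x ∈Neg ν A _   = suc x ∈Neg A

private
  variable
    k m n m′ n′ : ℕ

------------------------------------------------------------------------

private
  lift-unique : (ρ : Fin m → Fin n) {x : Fin m} {z : Fin n} →
                (∀ y → ρ y ≡ z → y ≡ x) →
                ∀ y → lift 1 ρ y ≡ suc z → y ≡ suc x
  lift-unique ρ h (suc y) e = cong suc (h y (suc-injective e))

  lift-zero : (ρ : Fin m → Fin n) → ∀ y → lift 1 ρ y ≡ zero → y ≡ zero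
  lift-zero ρ zero _ = refl

renᵗ : (Fin m → Fin n) → Ty m → Ty n
ren-pos : (ρ : Fin m → Fin n) {x : Fin m} {z : Fin n} (A : Ty m) →
          (∀ y → ρ y ≡ z → y ≡ x) → x ∈Pos A → z ∈Pos renᵗ ρ A
ren-neg : (ρ : Fin m → Fin n) {x : Fin m} {z : Fin n} (A : Ty m) →
          (∀ y → ρ y ≡ z → y ≡ x) → x ∈Neg A → z ∈Neg renᵗ ρ A

renᵗ ρ (tv x)  = tv (ρ x)
renᵗ ρ (A ∧ B) = renᵗ ρ A ∧ renᵗ ρ B
renᵗ ρ (A ∨ B) = renᵗ ρ A ∨ renᵗ ρ B
renᵗ ρ (~ A)   = ~ renᵗ ρ A
renᵗ ρ (μ A p) = μ (renᵗ (lift 1 ρ) A) (ren-pos (lift 1 ρ) A (lift-zero ρ) p)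
renᵗ ρ (ν A p) = ν (renᵗ (lift 1 ρ) A) (ren-pos (lift 1 ρ) A (lift-zero ρ) p)

ren-pos ρ (tv y)  h p       = tt
ren-pos ρ (A ∧ B) h (p , q) = ren-pos ρ A h p , ren-pos ρ B h q
ren-pos ρ (A ∨ B) h (p , q) = ren-pos ρ A h p , ren-pos ρ B h q
ren-pos ρ (~ A)   h p       = ren-neg ρ A h p
ren-pos ρ (μ A _) h p       = ren-pos (lift 1 ρ) A (lift-unique ρ h) p
ren-pos ρ (ν A _) h p       = ren-pos (lift 1 ρ) A (lift-unique ρ h) p

ren-neg ρ (tv y)  h p       = λ e → p (sym (h y (sym e)))
ren-neg ρ (A ∧ B) h (p , q) = ren-neg ρ A h p , ren-neg ρ B h q
ren-neg ρ (A ∨ B) h (p , q) = ren-neg ρ A h p , ren-neg ρ B h q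
ren-neg ρ (~ A)   h p       = ren-pos ρ A h p
ren-neg ρ (μ A _) h p       = ren-neg (lift 1 ρ) A (lift-unique ρ h) p
ren-neg ρ (ν A _) h p       = ren-neg (lift 1 ρ) A (lift-unique ρ h) p

wkᵗ : Ty n → Ty (suc n)
wkᵗ = renᵗ suc

private
  lift-avoids : (ρ : Fin m → Fin n) {z : Fin n} → (∀ y → ρ y ≢ z) →
                ∀ y → lift 1 ρ y ≢ suc z
  lift-avoids ρ h (suc y) e = h y (suc-injective e)

ren-avoids : (ρ : Fin m → Fin n) {z : Fin n} (A : Ty m) → (∀ y → ρ y ≢ z) →
             z ∈Pos renᵗ ρ A × z ∈Neg renᵗ ρ A
ren-avoids ρ (tv y)  h = tt , λ e → h y (sym e)
ren-avoids ρ (A ∧ B) h =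
  let (p , q) = ren-avoids ρ A h ; (p′ , q′) = ren-avoids ρ B h in (p , p′) , (q , q′)
ren-avoids ρ (A ∨ B) h =
  let (p , q) = ren-avoids ρ A h ; (p′ , q′) = ren-avoids ρ B h in (p , p′) , (q , q′)
ren-avoids ρ (~ A)   h = let (p , q) = ren-avoids ρ A h in q , p
ren-avoids ρ (μ A _) h = ren-avoids (lift 1 ρ) A (lift-avoids ρ h)
ren-avoids ρ (ν A _) h = ren-avoids (lift 1 ρ) A (lift-avoids ρ h)

extsᵗ : (Fin m → Ty n) → Fin (suc m) → Ty (suc n)
extsᵗ σ zero    = tv zero
extsᵗ σ (suc x) = wkᵗ (σ x)

-- `PosAt σ x z`: substituting along σ sends positive (negative) x to positive
-- (negative) z.

PosAt : (Fin m → Ty n) → Fin m → Fin n → Set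
PosAt σ x z = z ∈Pos σ x × (∀ y → y ≢ x → z ∈Pos σ y × z ∈Neg σ y)

private
  extsᵗ-zero : (σ : Fin m → Ty n) → PosAt (extsᵗ σ) zero zero
  extsᵗ-zero σ = tt , λ
    { zero    y≢x → contradiction refl y≢x
    ; (suc y) _   → ren-avoids suc (σ y) λ _ () }

  extsᵗ-suc : (σ : Fin m → Ty n) {x : Fin m} {z : Fin n} →
              PosAt σ x z → PosAt (extsᵗ σ) (suc x) (suc z)
  extsᵗ-suc σ {x} (p , h) = ren-pos suc (σ x) (λ _ → suc-injective) p , λ
    { zero    _   → tt , λ ()
    ; (suc y) y≢x → let (q , r) = h y (y≢x ∘ cong suc) in
                    ren-pos suc (σ y) (λ _ → suc-injective) q
                  , ren-neg suc (σ y) (λ _ → suc-injective) r }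

subᵗ : (Fin m → Ty n) → Ty m → Ty n
sub-pos : (σ : Fin m → Ty n) {x : Fin m} {z : Fin n} (A : Ty m) →
          PosAt σ x z → x ∈Pos A → z ∈Pos subᵗ σ A
sub-neg : (σ : Fin m → Ty n) {x : Fin m} {z : Fin n} (A : Ty m) →
          PosAt σ x z → x ∈Neg A → z ∈Neg subᵗ σ A

subᵗ σ (tv x)  = σ x
subᵗ σ (A ∧ B) = subᵗ σ A ∧ subᵗ σ B
subᵗ σ (A ∨ B) = subᵗ σ A ∨ subᵗ σ B
subᵗ σ (~ A)   = ~ subᵗ σ A
subᵗ σ (μ A p) = μ (subᵗ (extsᵗ σ) A) (sub-pos (extsᵗ σ) A (extsᵗ-zero σ) p)
subᵗ σ (ν A p) = ν (subᵗ (extsᵗ σ) A) (sub-pos (extsᵗ σ) A (extsᵗ-zero σ) p)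

sub-pos σ {x} (tv y) (p , h) _ with y ≟ x
... | yes refl = p
... | no  y≢x  = proj₁ (h y y≢x)
sub-pos σ (A ∧ B) h (p , q) = sub-pos σ A h p , sub-pos σ B h q
sub-pos σ (A ∨ B) h (p , q) = sub-pos σ A h p , sub-pos σ B h q
sub-pos σ (~ A)   h p       = sub-neg σ A h p
sub-pos σ (μ A _) h p       = sub-pos (extsᵗ σ) A (extsᵗ-suc σ h) p
sub-pos σ (ν A _) h p       = sub-pos (extsᵗ σ) A (extsᵗ-suc σ h) p

sub-neg σ (tv y)  (_ , h) p = proj₂ (h y (p ∘ sym))
sub-neg σ (A ∧ B) h (p , q) = sub-neg σ A h p , sub-neg σ B h q
sub-neg σ (A ∨ B) h (p , q) = sub-neg σ A h p , sub-neg σ B h q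
sub-neg σ (~ A)   h p       = sub-pos σ A h p
sub-neg σ (μ A _) h p       = sub-neg (extsᵗ σ) A (extsᵗ-suc σ h) p
sub-neg σ (ν A _) h p       = sub-neg (extsᵗ σ) A (extsᵗ-suc σ h) p

instᵗ : Ty n → Fin (suc n) → Ty n
instᵗ B zero    = B
instᵗ B (suc x) = tv x

infixl 9 _[_]ᵗ

_[_]ᵗ : Ty (suc n) → Ty n → Ty n
A [ B ]ᵗ = subᵗ (instᵗ B) A

-- subᵗ (extsᵗ (instᵗ B)) C is C[B/X] under one further binder Y, i.e. the body
-- of (μ C p) [ B ]ᵗ.

inst-pos : (B : Ty n) (C : Ty (suc (suc n))) → zero ∈Pos C →
           zero ∈Pos subᵗ (extsᵗ (instᵗ B)) C
inst-pos B C = sub-pos (extsᵗ (instᵗ B)) C (extsᵗ-zero (instᵗ B))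

------------------------------------------------------------------------

infix 10 _°ᵗ

_°ᵗ : Ty n → Ty n
°-pos : {x : Fin n} (A : Ty n) → x ∈Pos A → x ∈Pos (A °ᵗ)
°-neg : {x : Fin n} (A : Ty n) → x ∈Neg A → x ∈Neg (A °ᵗ)

(tv x)  °ᵗ = tv x
(A ∧ B) °ᵗ = A °ᵗ ∨ B °ᵗ
(A ∨ B) °ᵗ = A °ᵗ ∧ B °ᵗ
(~ A)   °ᵗ = ~ (A °ᵗ)
(μ A p) °ᵗ = ν (A °ᵗ) (°-pos A p)
(ν A p) °ᵗ = μ (A °ᵗ) (°-pos A p)

°-pos (tv y)  p       = p
°-pos (A ∧ B) (p , q) = °-pos A p , °-pos B q
°-pos (A ∨ B) (p , q) = °-pos A p , °-pos B q
°-pos (~ A)   p       = °-neg A p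
°-pos (μ A _) p       = °-pos A p
°-pos (ν A _) p       = °-pos A p

°-neg (tv y)  p       = p
°-neg (A ∧ B) (p , q) = °-neg A p , °-neg B q
°-neg (A ∨ B) (p , q) = °-neg A p , °-neg B q
°-neg (~ A)   p       = °-pos A p
°-neg (μ A _) p       = °-neg A p
°-neg (ν A _) p       = °-neg A p

------------------------------------------------------------------------

infix 4 _∈fv_ _∈fv?_

_∈fv_ : Fin n → Ty n → Set
x ∈fv tv y    = x ≡ y
x ∈fv (A ∧ B) = x ∈fv A ⊎ x ∈fv B
x ∈fv (A ∨ B) = x ∈fv A ⊎ x ∈fv B
x ∈fv (~ A)   = x ∈fv A
x ∈fv μ A _   = suc x ∈fv A
x ∈fv ν A _   = suc x ∈fv A

_∈fv?_ : (x : Fin n) (A : Ty n) → Dec (x ∈fv A)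
x ∈fv? tv y    = x ≟ y
x ∈fv? (A ∧ B) = (x ∈fv? A) ⊎-dec (x ∈fv? B)
x ∈fv? (A ∨ B) = (x ∈fv? A) ⊎-dec (x ∈fv? B)
x ∈fv? (~ A)   = x ∈fv? A
x ∈fv? μ A _   = suc x ∈fv? A
x ∈fv? ν A _   = suc x ∈fv? A

-- ∥ A ∥ x is ‖A‖ₓ; ∥ A ∥⁺ x is its value when x is free in A.

∥_∥_ ∥_∥⁺_ : Ty n → Fin n → ℕ
∥ A ∥ x = if does (x ∈fv? A) then ∥ A ∥⁺ x else 0

∥ tv _  ∥⁺ x = 1
∥ A ∧ B ∥⁺ x = ∥ A ∥ x ℕ.+ ∥ B ∥ x ℕ.+ 1
∥ A ∨ B ∥⁺ x = ∥ A ∥ x ℕ.+ ∥ B ∥ x ℕ.+ 1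
∥ ~ A   ∥⁺ x = ∥ A ∥ x ℕ.+ 1
∥ μ A _ ∥⁺ x = ∥ A ∥ (suc x) ℕ.+ ∥ A ∥ zero ℕ.+ 1
∥ ν A _ ∥⁺ x = ∥ A ∥ (suc x) ℕ.+ ∥ A ∥ zero ℕ.+ 1

private
  free-size : {x : Fin n} (A : Ty n) → x ∈fv A → ∥ A ∥ x ≡ ∥ A ∥⁺ x
  free-size {x = x} A h with x ∈fv? A
  ... | yes _ = refl
  ... | no ¬h = contradiction h ¬h

  <+1 : ∀ {a b c} → a ≤ b → c ≡ b ℕ.+ 1 → a < c
  <+1 {b = b} a≤b refl rewrite +-comm b 1 = s≤s a≤b

  fv-ren : (ρ : Fin m → Fin n) {z : Fin n} (A : Ty m) → (∀ y → ρ y ≢ z) →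
           ¬ (z ∈fv renᵗ ρ A)
  fv-ren ρ (tv y)  h e        = h y (sym e)
  fv-ren ρ (A ∧ B) h (inj₁ f) = fv-ren ρ A h f
  fv-ren ρ (A ∧ B) h (inj₂ f) = fv-ren ρ B h f
  fv-ren ρ (A ∨ B) h (inj₁ f) = fv-ren ρ A h f
  fv-ren ρ (A ∨ B) h (inj₂ f) = fv-ren ρ B h f
  fv-ren ρ (~ A)   h f        = fv-ren ρ A h f
  fv-ren ρ (μ A _) h f        = fv-ren (lift 1 ρ) A (lift-avoids ρ h) f
  fv-ren ρ (ν A _) h f        = fv-ren (lift 1 ρ) A (lift-avoids ρ h) f

  fv-wk : {z : Fin n} (A : Ty n) → suc z ∈fv wkᵗ A → z ∈fv A
  fv-wk A f = go suc suc-injective A f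
    where
    lift-inj : (ρ : Fin m → Fin n) → (∀ {x y} → ρ x ≡ ρ y → x ≡ y) →
               ∀ {x y} → lift 1 ρ x ≡ lift 1 ρ y → x ≡ y
    lift-inj ρ i {zero}  {zero}  e = refl
    lift-inj ρ i {suc x} {suc y} e = cong suc (i (suc-injective e))

    go : (ρ : Fin m → Fin n) → (∀ {x y} → ρ x ≡ ρ y → x ≡ y) →
         {z : Fin m} (A : Ty m) → ρ z ∈fv renᵗ ρ A → z ∈fv A
    go ρ i (tv y)  e = i e
    go ρ i (A ∧ B) f = Sum.map (go ρ i A) (go ρ i B) f
    go ρ i (A ∨ B) f = Sum.map (go ρ i A) (go ρ i B) f
    go ρ i (~ A)   f = go ρ i A f
    go ρ i (μ A _) f = go (lift 1 ρ) (λ {x} {y} → lift-inj ρ i {x} {y}) A f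
    go ρ i (ν A _) f = go (lift 1 ρ) (λ {x} {y} → lift-inj ρ i {x} {y}) A f

  Only : (Fin m → Ty n) → Fin m → Fin n → Set
  Only σ x z = σ x ≡ tv z × (∀ y → y ≢ x → ¬ (z ∈fv σ y))

  only-zero : (σ : Fin m → Ty n) → Only (extsᵗ σ) zero zero
  only-zero σ = refl , λ
    { zero    y≢x _ → y≢x refl
    ; (suc y) _   f → fv-ren suc (σ y) (λ _ ()) f }

  only-suc : (σ : Fin m → Ty n) {x : Fin m} {z : Fin n} →
             Only σ x z → Only (extsᵗ σ) (suc x) (suc z)
  only-suc σ (e , h) = cong wkᵗ e , λ
    { zero    _   ()
    ; (suc y) y≢x f → h y (y≢x ∘ cong suc) (fv-wk (σ y) f) }

  fv-sub : (σ : Fin m → Ty n) {x : Fin m} {z : Fin n} (A : Ty m) →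
           Only σ x z → z ∈fv subᵗ σ A → x ∈fv A
  fv-sub σ {x} (tv y) (_ , h) f with x ≟ y
  ... | yes x≡y = x≡y
  ... | no  x≢y = ⊥-elim (h y (x≢y ∘ sym) f)
  fv-sub σ (A ∧ B) h f = Sum.map (fv-sub σ A h) (fv-sub σ B h) f
  fv-sub σ (A ∨ B) h f = Sum.map (fv-sub σ A h) (fv-sub σ B h) f
  fv-sub σ (~ A)   h f = fv-sub σ A h f
  fv-sub σ (μ A _) h f = fv-sub (extsᵗ σ) A (only-suc σ h) f
  fv-sub σ (ν A _) h f = fv-sub (extsᵗ σ) A (only-suc σ h) f

  size-sub  : (σ : Fin m → Ty n) {x : Fin m} {z : Fin n} (A : Ty m) →
              Only σ x z → ∥ subᵗ σ A ∥ z ≤ ∥ A ∥ x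
  size-sub⁺ : (σ : Fin m → Ty n) {x : Fin m} {z : Fin n} (A : Ty m) →
              Only σ x z → x ∈fv A → ∥ subᵗ σ A ∥⁺ z ≤ ∥ A ∥⁺ x

  size-sub σ {x} {z} A h with z ∈fv? subᵗ σ A
  ... | no  _ = z≤n
  ... | yes f = ≤-trans (size-sub⁺ σ A h f′) (≤-reflexive (sym (free-size A f′)))
    where f′ = fv-sub σ A h f

  size-sub⁺ σ (tv y)  (e , _) refl rewrite e = ≤-refl
  size-sub⁺ σ (A ∧ B) h _ = +-monoˡ-≤ 1 (+-mono-≤ (size-sub σ A h) (size-sub σ B h))
  size-sub⁺ σ (A ∨ B) h _ = +-monoˡ-≤ 1 (+-mono-≤ (size-sub σ A h) (size-sub σ B h))
  size-sub⁺ σ (~ A)   h _ = +-monoˡ-≤ 1 (size-sub σ A h)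
  size-sub⁺ σ (μ A _) h _ =
    +-monoˡ-≤ 1 (+-mono-≤ (size-sub (extsᵗ σ) A (only-suc σ h))
                          (size-sub (extsᵗ σ) A (only-zero σ)))
  size-sub⁺ σ (ν A _) h _ =
    +-monoˡ-≤ 1 (+-mono-≤ (size-sub (extsᵗ σ) A (only-suc σ h))
                          (size-sub (extsᵗ σ) A (only-zero σ)))

  only-inst : (T : Ty n) → Only (instᵗ (wkᵗ T)) (suc zero) zero
  only-inst T = refl , λ
    { zero          _   f → fv-ren suc T (λ _ ()) f
    ; (suc zero)    y≢x _ → y≢x refl
    ; (suc (suc y)) _   () }

  ∧<₁ : {x : Fin n} (C D : Ty n) → x ∈fv (C ∧ D) → ∥ C ∥ x < ∥ C ∧ D ∥ x
  ∧<₁ C D f = <+1 (m≤m+n _ _) (free-size (C ∧ D) f)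

  ∧<₂ : {x : Fin n} (C D : Ty n) → x ∈fv (C ∧ D) → ∥ D ∥ x < ∥ C ∧ D ∥ x
  ∧<₂ C D f = <+1 (m≤n+m _ _) (free-size (C ∧ D) f)

  ∨<₁ : {x : Fin n} (C D : Ty n) → x ∈fv (C ∨ D) → ∥ C ∥ x < ∥ C ∨ D ∥ x
  ∨<₁ C D f = <+1 (m≤m+n _ _) (free-size (C ∨ D) f)

  ∨<₂ : {x : Fin n} (C D : Ty n) → x ∈fv (C ∨ D) → ∥ D ∥ x < ∥ C ∨ D ∥ x
  ∨<₂ C D f = <+1 (m≤n+m _ _) (free-size (C ∨ D) f)

  ~< : {x : Fin n} (C : Ty n) → x ∈fv (~ C) → ∥ C ∥ x < ∥ ~ C ∥ x
  ~< C f = <+1 ≤-refl (free-size (~ C) f)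

  μ< : (C : Ty (suc (suc n))) .(p : zero ∈Pos C) (T : Ty n) → zero ∈fv μ C p →
       ∥ C [ wkᵗ T ]ᵗ ∥ zero < ∥ μ C p ∥ zero
  μ< C p T f =
    <+1 (≤-trans (size-sub _ C (only-inst T)) (m≤m+n _ _)) (free-size (μ C p) f)

  ν< : (C : Ty (suc (suc n))) .(p : zero ∈Pos C) (T : Ty n) → zero ∈fv ν C p →
       ∥ C [ wkᵗ T ]ᵗ ∥ zero < ∥ ν C p ∥ zero
  ν< C p T f =
    <+1 (≤-trans (size-sub _ C (only-inst T)) (m≤m+n _ _)) (free-size (ν C p) f)

------------------------------------------------------------------------
-- `Exp k s m n` has k type variables, m variables and
-- n covariables in scope; binders bind index zero.  The involution between
-- variables and covariables exchanges the variable and the covariable with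
-- the same index.

data Sort : Set where
  term coterm stmt : Sort

infix 5 _•_
infix 6 _·α x·_

data Exp (k : ℕ) : Sort → ℕ → ℕ → Set where
  var     : Fin m → Exp k term m n
  ⟨_,_⟩   : Exp k term m n → Exp k term m n → Exp k term m n
  ⟨_⟩inl  : Exp k term m n → Exp k term m n
  ⟨_⟩inr  : Exp k term m n → Exp k term m n
  [_]not  : Exp k coterm m n → Exp k term m n
  _·α     : Exp k stmt m (suc n) → Exp k term m n
  inμ     : (C : Ty (suc k)) → .(zero ∈Pos C) → Exp k term m n → Exp k term m n
  coitr   : Ty k → Exp k term (suc m) n → Exp k term m n → Exp k term m n

  covar   : Fin n → Exp k coterm m n
  [_,_]   : Exp k coterm m n → Exp k coterm m n → Exp k coterm m n
  fst[_]  : Exp k coterm m n → Exp k coterm m n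
  snd[_]  : Exp k coterm m n → Exp k coterm m n
  not⟨_⟩  : Exp k term m n → Exp k coterm m n
  x·_     : Exp k stmt (suc m) n → Exp k coterm m n
  outν    : (C : Ty (suc k)) → .(zero ∈Pos C) → Exp k coterm m n → Exp k coterm m n
  itr     : Ty k → Exp k coterm m (suc n) → Exp k coterm m n → Exp k coterm m n

  _•_     : Exp k term m n → Exp k coterm m n → Exp k stmt m n

Term Coterm Stmt : ℕ → ℕ → ℕ → Set
Term   k = Exp k term
Coterm k = Exp k coterm
Stmt   k = Exp k stmt

private
  variable
    s : Sort

ren : (Fin m → Fin m′) → (Fin n → Fin n′) → Exp k s m n → Exp k s m′ n′
ren ρ θ (var x)       = var (ρ x)
ren ρ θ ⟨ M , N ⟩     = ⟨ ren ρ θ M , ren ρ θ N ⟩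
ren ρ θ ⟨ M ⟩inl      = ⟨ ren ρ θ M ⟩inl
ren ρ θ ⟨ M ⟩inr      = ⟨ ren ρ θ M ⟩inr
ren ρ θ [ K ]not      = [ ren ρ θ K ]not
ren ρ θ (S ·α)        = (ren ρ (lift 1 θ) S) ·α
ren ρ θ (inμ C p M)   = inμ C p (ren ρ θ M)
ren ρ θ (coitr A M N) = coitr A (ren (lift 1 ρ) θ M) (ren ρ θ N)
ren ρ θ (covar a)     = covar (θ a)
ren ρ θ [ K , L ]     = [ ren ρ θ K , ren ρ θ L ]
ren ρ θ fst[ K ]      = fst[ ren ρ θ K ]
ren ρ θ snd[ K ]      = snd[ ren ρ θ K ]
ren ρ θ not⟨ M ⟩      = not⟨ ren ρ θ M ⟩
ren ρ θ (x· S)        = x· (ren (lift 1 ρ) θ S)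
ren ρ θ (outν C p K)  = outν C p (ren ρ θ K)
ren ρ θ (itr A K L)   = itr A (ren ρ (lift 1 θ) K) (ren ρ θ L)
ren ρ θ (M • K)       = ren ρ θ M • ren ρ θ K

wkᵛ : Exp k s m n → Exp k s (suc m) n
wkᵛ = ren suc id

wkᶜ : Exp k s m n → Exp k s m (suc n)
wkᶜ = ren id suc

suc² : Fin n → Fin (suc (suc n))
suc² i = suc (suc i)

extsᵛ : (Fin m → Term k m′ n′) → Fin (suc m) → Term k (suc m′) n′
extsᵛ σ zero    = var zero
extsᵛ σ (suc x) = wkᵛ (σ x)

extsᶜ : (Fin n → Coterm k m′ n′) → Fin (suc n) → Coterm k m′ (suc n′)
extsᶜ τ zero    = covar zero
extsᶜ τ (suc a) = wkᶜ (τ a)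

sub : (Fin m → Term k m′ n′) → (Fin n → Coterm k m′ n′) →
      Exp k s m n → Exp k s m′ n′
sub σ τ (var x)       = σ x
sub σ τ ⟨ M , N ⟩     = ⟨ sub σ τ M , sub σ τ N ⟩
sub σ τ ⟨ M ⟩inl      = ⟨ sub σ τ M ⟩inl
sub σ τ ⟨ M ⟩inr      = ⟨ sub σ τ M ⟩inr
sub σ τ [ K ]not      = [ sub σ τ K ]not
sub σ τ (S ·α)        = (sub (wkᶜ ∘ σ) (extsᶜ τ) S) ·α
sub σ τ (inμ C p M)   = inμ C p (sub σ τ M)
sub σ τ (coitr A M N) = coitr A (sub (extsᵛ σ) (wkᵛ ∘ τ) M) (sub σ τ N)
sub σ τ (covar a)     = τ a
sub σ τ [ K , L ]     = [ sub σ τ K , sub σ τ L ]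
sub σ τ fst[ K ]      = fst[ sub σ τ K ]
sub σ τ snd[ K ]      = snd[ sub σ τ K ]
sub σ τ not⟨ M ⟩      = not⟨ sub σ τ M ⟩
sub σ τ (x· S)        = x· (sub (extsᵛ σ) (wkᵛ ∘ τ) S)
sub σ τ (outν C p K)  = outν C p (sub σ τ K)
sub σ τ (itr A K L)   = itr A (sub (wkᶜ ∘ σ) (extsᶜ τ) K) (sub σ τ L)
sub σ τ (M • K)       = sub σ τ M • sub σ τ K

instᵛ : Term k m n → Fin (suc m) → Term k m n
instᵛ M zero    = M
instᵛ M (suc x) = var x

instᶜ : Coterm k m n → Fin (suc n) → Coterm k m n
instᶜ K zero    = K
instᶜ K (suc a) = covar a

infixl 9 _[_/x] _[_/α]

_[_/x] : Exp k s (suc m) n → Term k m n → Exp k s m n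
E [ M /x] = sub (instᵛ M) covar E

_[_/α] : Exp k s m (suc n) → Coterm k m n → Exp k s m n
E [ K /α] = sub var (instᶜ K) E

------------------------------------------------------------------------

infix 10 _°ˢ _°

_°ˢ : Sort → Sort
term   °ˢ = coterm
coterm °ˢ = term
stmt   °ˢ = stmt

_° : Exp k s m n → Exp k (s °ˢ) n m
(var x)       ° = covar x
⟨ M , N ⟩     ° = [ M ° , N ° ]
⟨ M ⟩inl      ° = fst[ M ° ]
⟨ M ⟩inr      ° = snd[ M ° ]
[ K ]not      ° = not⟨ K ° ⟩
(S ·α)        ° = x· (S °)
(inμ C p M)   ° = outν (C °ᵗ) (°-pos C p) (M °)
(coitr A M N) ° = itr (A °ᵗ) (M °) (N °)
(covar a)     ° = var a
[ K , L ]     ° = ⟨ K ° , L ° ⟩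
fst[ K ]      ° = ⟨ K ° ⟩inl
snd[ K ]      ° = ⟨ K ° ⟩inr
not⟨ M ⟩      ° = [ M ° ]not
(x· S)        ° = (S °) ·α
(outν C p K)  ° = inμ (C °ᵗ) (°-pos C p) (K °)
(itr A K L)   ° = coitr (A °ᵗ) (K °) (L °)
(M • K)       ° = K ° • M °

------------------------------------------------------------------------
-- mono C A B M N is mono^{X.C}_{A,B,x.M}{N}: X is index zero of C, and x is
-- index zero of M.  That X is not free in A and B is enforced by their scope.
-- The clause for X not free in C takes precedence over the structural ones;
-- those apply only when X is free, where the measure strictly decreases.

mono-acc : (C : Ty (suc k)) (A B : Ty k) → Term k (suc m) n → Term k m n →
           Acc _<_ (∥ C ∥ zero) → Term k m n
mono-dec : (C : Ty (suc k)) (A B : Ty k) → Term k (suc m) n → Term k m n →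
           Acc _<_ (∥ C ∥ zero) → Dec (zero ∈fv C) → Term k m n

mono-acc C A B M N a = mono-dec C A B M N a (zero ∈fv? C)

mono-dec C A B M N _ (no _) = N
mono-dec (tv zero) A B M N _ (yes _) =
  (wkᶜ N • x· (wkᶜ M • covar zero)) ·α
mono-dec (C ∧ D) A B M N (acc rs) (yes f) =
  ⟨ mono-acc C A B M ((wkᶜ N • fst[ covar zero ]) ·α) (rs (∧<₁ C D f))
  , mono-acc D A B M ((wkᶜ N • snd[ covar zero ]) ·α) (rs (∧<₂ C D f)) ⟩
mono-dec (C ∨ D) A B M N (acc rs) (yes f) =
  (wkᶜ N •
    [ x· (⟨ mono-acc C A B M′ (var zero) (rs (∨<₁ C D f)) ⟩inl • covar zero)
    , x· (⟨ mono-acc D A B M′ (var zero) (rs (∨<₂ C D f)) ⟩inr • covar zero) ]) ·α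
  where M′ = ren (lift 1 suc) suc M
mono-dec (~ C) A B M N (acc rs) (yes f) =
  [ x· (wkᵛ N • not⟨ mono-acc C B A (ren (lift 1 suc) id M) (var zero) (rs (~< C f)) ⟩) ]not
mono-dec (μ C p) A B M N (acc rs) (yes f) =
  let T = μ C p [ B ]ᵗ in
  (wkᶜ N • itr T
    (x· (inμ (subᵗ (extsᵗ (instᵗ B)) C) (inst-pos B C p)
           (mono-acc (C [ wkᵗ T ]ᵗ) A B (ren (lift 1 suc) suc² M)
                     (var zero) (rs (μ< C p T f)))
         • covar zero))
    (covar zero)) ·α
mono-dec (ν C p) A B M N (acc rs) (yes f) =
  let T = ν C p [ A ]ᵗ in
  coitr T
    (mono-acc (C [ wkᵗ T ]ᵗ) A B (ren (lift 1 suc) id M)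
              ((var zero • outν (subᵗ (extsᵗ (instᵗ A)) C) (inst-pos A C p)
                                (covar zero)) ·α)
              (rs (ν< C p T f)))
    N

mono : (C : Ty (suc k)) (A B : Ty k) → Term k (suc m) n → Term k m n → Term k m n
mono C A B M N = mono-acc C A B M N (<-wellFounded (∥ C ∥ zero))

comono : (C : Ty (suc k)) (A B : Ty k) → Coterm k m (suc n) → Coterm k m n →
         Coterm k m n
comono C A B K L = (mono (C °ᵗ) (B °ᵗ) (A °ᵗ) (K °) (L °)) °

------------------------------------------------------------------------

infix 3 _↦_ _⟶_

data _↦_ {k m n : ℕ} : Exp k s m n → Exp k s m n → Set where
  ∧₁ : {M N : Term k m n} {K : Coterm k m n} → ⟨ M , N ⟩ • fst[ K ] ↦ M • K
  ∧₂ : {M N : Term k m n} {K : Coterm k m n} → ⟨ M , N ⟩ • snd[ K ] ↦ N • K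
  ∨₁ : {M : Term k m n} {K L : Coterm k m n} → ⟨ M ⟩inl • [ K , L ] ↦ M • K
  ∨₂ : {M : Term k m n} {K L : Coterm k m n} → ⟨ M ⟩inr • [ K , L ] ↦ M • L
  β~ : {K : Coterm k m n} {M : Term k m n} → [ K ]not • not⟨ M ⟩ ↦ M • K
  βR : {S : Stmt k m (suc n)} {K : Coterm k m n} → (S ·α) • K ↦ S [ K /α]
  βL : {M : Term k m n} {S : Stmt k (suc m) n} → M • (x· S) ↦ S [ M /x]
  ηR : {M : Term k m n} → (wkᶜ M • covar zero) ·α ↦ M
  ηL : {K : Coterm k m n} → x· (var zero • wkᵛ K) ↦ K

  -- In itr A K β the body K keeps its own bound covariable (index zero) and is
  -- weakened past β and past the α bound by the contractum.
  βμ : {C : Ty (suc k)} .{p : zero ∈Pos C} {A : Ty k}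
       {M : Term k m n} {K : Coterm k m (suc n)} {L : Coterm k m n} →
       inμ C p M • itr A K L ↦
       (wkᶜ M • comono C (μ C p) A
                  (itr A (ren id (lift 1 suc²) K) (covar zero)) K) ·α • L
  βν : {C : Ty (suc k)} .{p : zero ∈Pos C} {A : Ty k}
       {M : Term k (suc m) n} {N : Term k m n} {K : Coterm k m n} →
       coitr A M N • outν C p K ↦
       N • x· (mono C A (ν C p)
                 (coitr A (ren (lift 1 suc²) id M) (var zero)) M • wkᵛ K)

data _⟶_ {k : ℕ} : Exp k s m n → Exp k s m n → Set where
  root    : {D E : Exp k s m n} → D ↦ E → D ⟶ E

  pair₁   : {M M′ N : Term k m n} → M ⟶ M′ → ⟨ M , N ⟩ ⟶ ⟨ M′ , N ⟩
  pair₂   : {M N N′ : Term k m n} → N ⟶ N′ → ⟨ M , N ⟩ ⟶ ⟨ M , N′ ⟩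
  inl     : {M M′ : Term k m n} → M ⟶ M′ → ⟨ M ⟩inl ⟶ ⟨ M′ ⟩inl
  inr     : {M M′ : Term k m n} → M ⟶ M′ → ⟨ M ⟩inr ⟶ ⟨ M′ ⟩inr
  notR    : {K K′ : Coterm k m n} → K ⟶ K′ → [ K ]not ⟶ [ K′ ]not
  absR    : {S S′ : Stmt k m (suc n)} → S ⟶ S′ → S ·α ⟶ S′ ·α
  inμ     : {C : Ty (suc k)} .{p : zero ∈Pos C} {M M′ : Term k m n} →
            M ⟶ M′ → inμ C p M ⟶ inμ C p M′
  coitr₁  : {A : Ty k} {M M′ : Term k (suc m) n} {N : Term k m n} →
            M ⟶ M′ → coitr A M N ⟶ coitr A M′ N
  coitr₂  : {A : Ty k} {M : Term k (suc m) n} {N N′ : Term k m n} →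
            N ⟶ N′ → coitr A M N ⟶ coitr A M N′

  copair₁ : {K K′ L : Coterm k m n} → K ⟶ K′ → [ K , L ] ⟶ [ K′ , L ]
  copair₂ : {K L L′ : Coterm k m n} → L ⟶ L′ → [ K , L ] ⟶ [ K , L′ ]
  fst     : {K K′ : Coterm k m n} → K ⟶ K′ → fst[ K ] ⟶ fst[ K′ ]
  snd     : {K K′ : Coterm k m n} → K ⟶ K′ → snd[ K ] ⟶ snd[ K′ ]
  notL    : {M M′ : Term k m n} → M ⟶ M′ → not⟨ M ⟩ ⟶ not⟨ M′ ⟩
  absL    : {S S′ : Stmt k (suc m) n} → S ⟶ S′ → x· S ⟶ x· S′
  outν    : {C : Ty (suc k)} .{p : zero ∈Pos C} {K K′ : Coterm k m n} →
            K ⟶ K′ → outν C p K ⟶ outν C p K′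
  itr₁    : {A : Ty k} {K K′ : Coterm k m (suc n)} {L : Coterm k m n} →
            K ⟶ K′ → itr A K L ⟶ itr A K′ L
  itr₂    : {A : Ty k} {K : Coterm k m (suc n)} {L L′ : Coterm k m n} →
            L ⟶ L′ → itr A K L ⟶ itr A K L′

  cut₁    : {M M′ : Term k m n} {K : Coterm k m n} → M ⟶ M′ → M • K ⟶ M′ • K
  cut₂    : {M : Term k m n} {K K′ : Coterm k m n} → K ⟶ K′ → M • K ⟶ M • K′

{-# OPTIONS --safe #-}
module Submission where

open import Data.Fin.Base using (Fin; zero; suc; lift)
open import Data.Nat.Base using (ℕ; suc)
open import Function.Base using (id)
open import Relation.Binary.PropositionalEquality
  using (_≡_; refl; sym; trans; cong; cong₂; subst; module ≡-Reasoning)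
open import Defs

-- Duality is an involution that commutes with renaming and substitution.  The
-- cases of (βμ) and (βν) need no induction over mono, because the operator on
-- coterms is by definition the dual of the one on terms: duality turns one of
-- them into the other up to double duals.

private
  variable
    k m n m′ n′ : ℕ
    s : Sort

°ᵗ-involutive : (A : Ty n) → A °ᵗ °ᵗ ≡ A

-- Positivity proofs are irrelevant, so `p` and `q` need no equation: once the bodies agree, the two
-- fixed points agree by computation.
μ-cong : {A B : Ty (suc n)} .{p : zero ∈Pos A} .{q : zero ∈Pos B} →
         A ≡ B → μ A p ≡ μ B q
μ-cong refl = refl

ν-cong : {A B : Ty (suc n)} .{p : zero ∈Pos A} .{q : zero ∈Pos B} →
         A ≡ B → ν A p ≡ ν B q
ν-cong refl = refl

°ᵗ-involutive (tv x)  = refl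
°ᵗ-involutive (A ∧ B) = cong₂ _∧_ (°ᵗ-involutive A) (°ᵗ-involutive B)
°ᵗ-involutive (A ∨ B) = cong₂ _∨_ (°ᵗ-involutive A) (°ᵗ-involutive B)
°ᵗ-involutive (~ A)   = cong ~_ (°ᵗ-involutive A)
°ᵗ-involutive (μ A p) = μ-cong (°ᵗ-involutive A)
°ᵗ-involutive (ν A p) = ν-cong (°ᵗ-involutive A)

inμ-cong : {C D : Ty (suc k)} .{p : zero ∈Pos C} .{q : zero ∈Pos D}
           {M N : Term k m n} → C ≡ D → M ≡ N → inμ C p M ≡ inμ D q N
inμ-cong refl refl = refl

outν-cong : {C D : Ty (suc k)} .{p : zero ∈Pos C} .{q : zero ∈Pos D}
            {K L : Coterm k m n} → C ≡ D → K ≡ L → outν C p K ≡ outν D q L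
outν-cong refl refl = refl

coitr-cong : {A B : Ty k} {M M′ : Term k (suc m) n} {N N′ : Term k m n} →
             A ≡ B → M ≡ M′ → N ≡ N′ → coitr A M N ≡ coitr B M′ N′
coitr-cong refl refl refl = refl

itr-cong : {A B : Ty k} {K K′ : Coterm k m (suc n)} {L L′ : Coterm k m n} →
           A ≡ B → K ≡ K′ → L ≡ L′ → itr A K L ≡ itr B K′ L′
itr-cong refl refl refl = refl

°ˢ-involutive : (s : Sort) → s °ˢ °ˢ ≡ s
°ˢ-involutive term   = refl
°ˢ-involutive coterm = refl
°ˢ-involutive stmt   = refl

-- `s °ˢ °ˢ` reduces to `s` only for a known sort, hence the transport. Each constructor fixes the
-- sort, so the transport vanishes in every case.
°-involutive : (E : Exp k s m n) →
               subst (λ s → Exp k s m n) (°ˢ-involutive s) (E ° °) ≡ E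
°-involutive (var x)       = refl
°-involutive ⟨ M , N ⟩     = cong₂ ⟨_,_⟩ (°-involutive M) (°-involutive N)
°-involutive ⟨ M ⟩inl      = cong ⟨_⟩inl (°-involutive M)
°-involutive ⟨ M ⟩inr      = cong ⟨_⟩inr (°-involutive M)
°-involutive [ K ]not      = cong [_]not (°-involutive K)
°-involutive (S ·α)        = cong _·α (°-involutive S)
°-involutive (inμ C p M)   = inμ-cong (°ᵗ-involutive C) (°-involutive M)
°-involutive (coitr A M N) =
  coitr-cong (°ᵗ-involutive A) (°-involutive M) (°-involutive N)
°-involutive (covar a)     = refl
°-involutive [ K , L ]     = cong₂ [_,_] (°-involutive K) (°-involutive L)
°-involutive fst[ K ]      = cong fst[_] (°-involutive K)
°-involutive snd[ K ]      = cong snd[_] (°-involutive K)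
°-involutive not⟨ M ⟩      = cong not⟨_⟩ (°-involutive M)
°-involutive (x· S)        = cong x·_ (°-involutive S)
°-involutive (outν C p K)  = outν-cong (°ᵗ-involutive C) (°-involutive K)
°-involutive (itr A K L)   =
  itr-cong (°ᵗ-involutive A) (°-involutive K) (°-involutive L)
°-involutive (M • K)       = cong₂ _•_ (°-involutive M) (°-involutive K)

ren-° : (ρ : Fin m → Fin m′) (θ : Fin n → Fin n′) (E : Exp k s m n) →
        (ren ρ θ E) ° ≡ ren θ ρ (E °)
ren-° ρ θ (var x)       = refl
ren-° ρ θ ⟨ M , N ⟩     = cong₂ [_,_] (ren-° ρ θ M) (ren-° ρ θ N)
ren-° ρ θ ⟨ M ⟩inl      = cong fst[_] (ren-° ρ θ M)
ren-° ρ θ ⟨ M ⟩inr      = cong snd[_] (ren-° ρ θ M)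
ren-° ρ θ [ K ]not      = cong not⟨_⟩ (ren-° ρ θ K)
ren-° ρ θ (S ·α)        = cong x·_ (ren-° ρ (lift 1 θ) S)
ren-° ρ θ (inμ C p M)   = cong (outν (C °ᵗ) _) (ren-° ρ θ M)
ren-° ρ θ (coitr A M N) = cong₂ (itr (A °ᵗ)) (ren-° (lift 1 ρ) θ M) (ren-° ρ θ N)
ren-° ρ θ (covar a)     = refl
ren-° ρ θ [ K , L ]     = cong₂ ⟨_,_⟩ (ren-° ρ θ K) (ren-° ρ θ L)
ren-° ρ θ fst[ K ]      = cong ⟨_⟩inl (ren-° ρ θ K)
ren-° ρ θ snd[ K ]      = cong ⟨_⟩inr (ren-° ρ θ K)
ren-° ρ θ not⟨ M ⟩      = cong [_]not (ren-° ρ θ M)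
ren-° ρ θ (x· S)        = cong _·α (ren-° (lift 1 ρ) θ S)
ren-° ρ θ (outν C p K)  = cong (inμ (C °ᵗ) _) (ren-° ρ θ K)
ren-° ρ θ (itr A K L)   = cong₂ (coitr (A °ᵗ)) (ren-° ρ (lift 1 θ) K) (ren-° ρ θ L)
ren-° ρ θ (M • K)       = cong₂ _•_ (ren-° ρ θ K) (ren-° ρ θ M)

-- Pointwise hypotheses, since function extensionality is not available.
module _ {k : ℕ} where

  Dualᵛ : (Fin m → Term k m′ n′) → (Fin m → Coterm k n′ m′) → Set
  Dualᵛ σ σ° = ∀ x → (σ x) ° ≡ σ° x

  Dualᶜ : (Fin n → Coterm k m′ n′) → (Fin n → Term k n′ m′) → Set
  Dualᶜ τ τ° = ∀ a → (τ a) ° ≡ τ° a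

  -- This and the next three lemmas carry a dual pair of substitutions under a binder, where duality
  -- also exchanges the kind of name bound.
  wkᶜ-dual : {σ : Fin m → Term k m′ n′} {σ° : Fin m → Coterm k n′ m′} →
             Dualᵛ σ σ° → Dualᵛ (λ x → wkᶜ (σ x)) (λ x → wkᵛ (σ° x))
  wkᶜ-dual {σ = σ} d x = trans (ren-° id suc (σ x)) (cong wkᵛ (d x))

  wkᵛ-dual : {τ : Fin n → Coterm k m′ n′} {τ° : Fin n → Term k n′ m′} →
             Dualᶜ τ τ° → Dualᶜ (λ a → wkᵛ (τ a)) (λ a → wkᶜ (τ° a))
  wkᵛ-dual {τ = τ} d a = trans (ren-° suc id (τ a)) (cong wkᶜ (d a))

  extsᵛ-dual : {σ : Fin m → Term k m′ n′} {σ° : Fin m → Coterm k n′ m′} →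
               Dualᵛ σ σ° → Dualᵛ (extsᵛ σ) (extsᶜ σ°)
  extsᵛ-dual d zero = refl
  extsᵛ-dual {σ = σ} d (suc x) = trans (ren-° suc id (σ x)) (cong wkᶜ (d x))

  extsᶜ-dual : {τ : Fin n → Coterm k m′ n′} {τ° : Fin n → Term k n′ m′} →
               Dualᶜ τ τ° → Dualᶜ (extsᶜ τ) (extsᵛ τ°)
  extsᶜ-dual d zero = refl
  extsᶜ-dual {τ = τ} d (suc a) = trans (ren-° id suc (τ a)) (cong wkᵛ (d a))

  -- The dual substitutions are separate data rather than composites with `_°`, so that `instᵛ`,
  -- `instᶜ`, `var` and `covar` can be supplied directly.
  sub-° : {σ : Fin m → Term k m′ n′} {τ : Fin n → Coterm k m′ n′}
          {σ° : Fin m → Coterm k n′ m′} {τ° : Fin n → Term k n′ m′} →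
          Dualᵛ σ σ° → Dualᶜ τ τ° → (E : Exp k s m n) →
          (sub σ τ E) ° ≡ sub τ° σ° (E °)
  sub-° d e (var x)       = d x
  sub-° d e ⟨ M , N ⟩     = cong₂ [_,_] (sub-° d e M) (sub-° d e N)
  sub-° d e ⟨ M ⟩inl      = cong fst[_] (sub-° d e M)
  sub-° d e ⟨ M ⟩inr      = cong snd[_] (sub-° d e M)
  sub-° d e [ K ]not      = cong not⟨_⟩ (sub-° d e K)
  sub-° d e (S ·α)        = cong x·_ (sub-° (wkᶜ-dual d) (extsᶜ-dual e) S)
  sub-° d e (inμ C p M)   = cong (outν (C °ᵗ) _) (sub-° d e M)
  sub-° d e (coitr A M N) =
    cong₂ (itr (A °ᵗ)) (sub-° (extsᵛ-dual d) (wkᵛ-dual e) M) (sub-° d e N)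
  sub-° d e (covar a)     = e a
  sub-° d e [ K , L ]     = cong₂ ⟨_,_⟩ (sub-° d e K) (sub-° d e L)
  sub-° d e fst[ K ]      = cong ⟨_⟩inl (sub-° d e K)
  sub-° d e snd[ K ]      = cong ⟨_⟩inr (sub-° d e K)
  sub-° d e not⟨ M ⟩      = cong [_]not (sub-° d e M)
  sub-° d e (x· S)        = cong _·α (sub-° (extsᵛ-dual d) (wkᵛ-dual e) S)
  sub-° d e (outν C p K)  = cong (inμ (C °ᵗ) _) (sub-° d e K)
  sub-° d e (itr A K L)   =
    cong₂ (coitr (A °ᵗ)) (sub-° (wkᶜ-dual d) (extsᶜ-dual e) K) (sub-° d e L)
  sub-° d e (M • K)       = cong₂ _•_ (sub-° d e K) (sub-° d e M)

-- `instᶜ K` and `instᵛ (K °)` are dual at each index by computation. With its mirror image below,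
-- this exchanges the contracta of `βR` and `βL`.
[/α]-° : (E : Exp k s m (suc n)) (K : Coterm k m n) →
         (E [ K /α]) ° ≡ E ° [ K ° /x]
[/α]-° E K = sub-° (λ _ → refl) (λ { zero → refl ; (suc a) → refl }) E

[/x]-° : (E : Exp k s (suc m) n) (M : Term k m n) →
         (E [ M /x]) ° ≡ E ° [ M ° /α]
[/x]-° E M = sub-° (λ { zero → refl ; (suc x) → refl }) (λ _ → refl) E

-- `C` occurs both as the type operated on and inside `ν C p`, so both occurrences are replaced at
-- once. No unfolding of the recursion is involved.
mono-ν-cong : {C C′ : Ty (suc k)} .{p : zero ∈Pos C} .{p′ : zero ∈Pos C′}
              {A A′ : Ty k} {M M′ : Term k (suc m) n} {N N′ : Term k m n} →
              C ≡ C′ → A ≡ A′ → M ≡ M′ → N ≡ N′ →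
              mono C A (ν C p) M N ≡ mono C′ A′ (ν C′ p′) M′ N′
mono-ν-cong refl refl refl refl = refl

module _ {k m n : ℕ} {C : Ty (suc k)} .{p : zero ∈Pos C} {A : Ty k} where

  open ≡-Reasoning

  -- Here the double dual surrounds a whole `mono` expression and is removed in one step; what
  -- remains is to move duality past the renaming in the body of `itr`.
  comono-μ-° : (K : Coterm k m (suc n)) →
    (comono C (μ C p) A (itr A (ren id (lift 1 suc²) K) (covar zero)) K) ° ≡
    mono (C °ᵗ) (A °ᵗ) (ν (C °ᵗ) (°-pos C p))
      (coitr (A °ᵗ) (ren (lift 1 suc²) id (K °)) (var zero)) (K °)
  comono-μ-° K = trans
    (°-involutive (mono (C °ᵗ) (A °ᵗ) ((μ C p) °ᵗ)
      ((itr A (ren id (lift 1 suc²) K) (covar zero)) °) (K °)))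
    (cong (λ L → mono (C °ᵗ) (A °ᵗ) ((μ C p) °ᵗ) (coitr (A °ᵗ) L (var zero)) (K °))
      (ren-° id (lift 1 suc²) K))

  -- Here the double duals sit in the arguments: the right side unfolds to the dual of `mono` at
  -- `C °ᵗ °ᵗ`, `A °ᵗ °ᵗ` and `M ° °`, so the equation is proved from right to left.
  mono-ν-° : (M : Term k (suc m) n) →
    (mono C A (ν C p) (coitr A (ren (lift 1 suc²) id M) (var zero)) M) ° ≡
    comono (C °ᵗ) (μ (C °ᵗ) (°-pos C p)) (A °ᵗ)
      (itr (A °ᵗ) (ren id (lift 1 suc²) (M °)) (covar zero)) (M °)
  mono-ν-° M = sym (cong _° (mono-ν-cong
    (°ᵗ-involutive C) (°ᵗ-involutive A)
    (coitr-cong (°ᵗ-involutive A)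
      (begin
        (ren id (lift 1 suc²) (M °)) ° ≡⟨ ren-° id (lift 1 suc²) (M °) ⟩
        ren (lift 1 suc²) id (M ° °)   ≡⟨ cong (ren (lift 1 suc²) id) (°-involutive M) ⟩
        ren (lift 1 suc²) id M         ∎)
      refl)
    (°-involutive M)))

-- Absorbs the gap between the contractum of a dual redex and the dual of the contractum, which may
-- agree only up to a proved equation.
root-≡ : {D E E′ : Exp k s m n} → D ↦ E → E′ ≡ E → D ⟶ E′
root-≡ r refl = root r

↦-° : {D E : Exp k s m n} → D ↦ E → D ° ⟶ E °
↦-° ∧₁ = root ∨₁
↦-° ∧₂ = root ∨₂
↦-° ∨₁ = root ∧₁
↦-° ∨₂ = root ∧₂
↦-° β~ = root β~
↦-° (βR {S = S} {K = K}) = root-≡ βL ([/α]-° S K)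
↦-° (βL {M = M} {S = S}) = root-≡ βR ([/x]-° S M)
↦-° (ηR {M = M}) =
  -- For the η rules the mismatch lies in the redex: the dual of a weakening has to be rewritten as
  -- a weakening before the dual rule matches.
  subst (λ K → x· (var zero • K) ⟶ M °) (sym (ren-° id suc M)) (root ηL)
↦-° (ηL {K = K}) =
  subst (λ M → (M • covar zero) ·α ⟶ K °) (sym (ren-° suc id K)) (root ηR)
-- The two equations match the two sides of the inner cut, which duality has swapped.
↦-° (βμ {p = p} {M = M} {K = K} {L = L}) = root-≡ βν
  (cong₂ (λ N J → L ° • x· (N • J)) (comono-μ-° {p = p} K) (ren-° id suc M))
↦-° (βν {p = p} {M = M} {N = N} {K = K}) = root-≡ βμ
  (cong₂ (λ J L → (J • L) ·α • N °) (ren-° suc id K) (mono-ν-° {p = p} M))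

theorem3p18 : ∀ {k m n : ℕ} {s : Sort} (D E : Exp k s m n) → D ⟶ E → D ° ⟶ E °
theorem3p18 _ _ (root r)    = ↦-° r
-- Each congruence rule goes to that of the dual constructor, at the same argument position except
-- for cuts.
theorem3p18 _ _ (pair₁ r)   = copair₁ (theorem3p18 _ _ r)
theorem3p18 _ _ (pair₂ r)   = copair₂ (theorem3p18 _ _ r)
theorem3p18 _ _ (inl r)     = fst (theorem3p18 _ _ r)
theorem3p18 _ _ (inr r)     = snd (theorem3p18 _ _ r)
theorem3p18 _ _ (notR r)    = notL (theorem3p18 _ _ r)
theorem3p18 _ _ (absR r)    = absL (theorem3p18 _ _ r)
theorem3p18 _ _ (inμ r)     = outν (theorem3p18 _ _ r)
theorem3p18 _ _ (coitr₁ r)  = itr₁ (theorem3p18 _ _ r)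
theorem3p18 _ _ (coitr₂ r)  = itr₂ (theorem3p18 _ _ r)
theorem3p18 _ _ (copair₁ r) = pair₁ (theorem3p18 _ _ r)
theorem3p18 _ _ (copair₂ r) = pair₂ (theorem3p18 _ _ r)
theorem3p18 _ _ (fst r)     = inl (theorem3p18 _ _ r)
theorem3p18 _ _ (snd r)     = inr (theorem3p18 _ _ r)
theorem3p18 _ _ (notL r)    = notR (theorem3p18 _ _ r)
theorem3p18 _ _ (absL r)    = absR (theorem3p18 _ _ r)
theorem3p18 _ _ (outν r)    = inμ (theorem3p18 _ _ r)
theorem3p18 _ _ (itr₁ r)    = coitr₁ (theorem3p18 _ _ r)
theorem3p18 _ _ (itr₂ r)    = coitr₂ (theorem3p18 _ _ r)
-- Duality reverses a cut, so the reduced side changes.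
theorem3p18 _ _ (cut₁ r)    = cut₂ (theorem3p18 _ _ r)
theorem3p18 _ _ (cut₂ r)    = cut₁ (theorem3p18 _ _ r)
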